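{- Let $\mathcal M=(M,<,+,0,\ldots)$ be a definably complete locally o-minimal expansion of an ordered abelian group. Let $C\subseteq M^m$ be a definable, closed and bounded set, let $s\in M$ with $s>0$, and let $\{f_t:C\to M\}_{0<t<s}$ be a definable family of functions which is pointwise convergent and is a definable family of equi-continuous functions. Then the family $\{f_t\}_{0<t<s}$ is uniformly convergent.
   Context: "Definable" means definable in $\mathcal M$ with parameters. $\mathcal M$ is definably complete if every definable subset of $M$ has a supremum and an infimum in $M\cup\{\pm\infty\}$; it is locally o-minimal if for every definable $X\subseteq M$ and every $a\in M$ there is an open interval $I\ni a$ such that $X\cap I$ is a finite union of points and open intervals. For $x=(x_1,\dots,x_n)\in M^n$, $|x|:=\max_i |x_i|$; $M^n$ carries the product of the order topology. A definable family of functions $\{f_t:C\to M\}_{0<t<s}$ means there is a definable $F:C\times(0,s)\to M$ with $f_t(x)=F(x,t)$. It is a family of equi-continuous functions if for all $\varepsilon>0$ and all $x\in C$ there is $\delta>0$ such that for all $t\in(0,s)$ and all $x'\in C$ with $|x-x'|<\delta$ we have $|F(x,t)-F(x',t)|<\varepsilon$. It is pointwise convergent if for every $\varepsilon>0$ and $x\in C$ there is $s'>0$ with $|f_t(x)-f_{t'}(x)|<\varepsilon$ for all $t,t'\in(0,s')$. It is uniformly convergent if for every $\varepsilon>0$ there is $s'>0$ with $|f_t(x)-f_{t'}(x)|<\varepsilon$ for all $x\in C$ and all $t,t'\in(0,s')$. -}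

module Defs where

open import Level using (Level) renaming (suc to lsuc)
open import Algebra.Core using (Op₁; Op₂)
open import Algebra.Structures using (IsAbelianGroup)
import Algebra.Construct.NaturalChoice.Max as NaturalMax
open import Data.Empty.Polymorphic using (⊥)
open import Data.Fin.Base using (Fin)
open import Data.List.Base using (List)
open import Data.List.Relation.Unary.Any using (Any)
open import Data.Nat.Base using (ℕ; suc)
open import Data.Product.Base using (Σ-syntax; ∃-syntax; _×_; proj₁; proj₂)
open import Data.Sum.Base using (_⊎_)
open import Data.Vec.Base using (Vec; []; _∷_; lookup; head; map; foldr′; zipWith)
open import Data.Vec.Relation.Binary.Pointwise.Inductive using (Pointwise)
open import Function.Base using (_∘_)
open import Function.Bundles using (_⇔_)
open import Relation.Binary.Bundles using (StrictTotalOrder)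
open import Relation.Binary.Core using (Rel)
open import Relation.Binary.PropositionalEquality.Core using (_≡_)
open import Relation.Binary.Structures using (IsStrictTotalOrder)
import Relation.Binary.Construct.Add.Extrema.NonStrict as AddExtremaNonStrict
import Relation.Binary.Construct.Add.Extrema.Strict as AddExtremaStrict
import Relation.Binary.Properties.StrictTotalOrder as StrictTotalOrderProperties
open import Relation.Nullary.Construct.Add.Extrema using (_±; [_])
open import Relation.Unary using (Pred; _∈_; _∩_; _⊆_; _≐_; ∁)

record OrderedAbelianGroup (ℓ : Level) : Set (lsuc ℓ) where
  infix  4 _<_
  infixl 6 _+_ _-_
  infix  8 -_
  field
    Carrier            : Set ℓ
    _<_                : Rel Carrier ℓ
    _+_                : Op₂ Carrier
    0#                 : Carrier
    -_                 : Op₁ Carrier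
    isAbelianGroup     : IsAbelianGroup _≡_ _+_ 0# -_
    isStrictTotalOrder : IsStrictTotalOrder _≡_ _<_
    +-monoʳ-<          : ∀ z {x y} → x < y → z + x < z + y

  _-_ : Op₂ Carrier
  x - y = x + (- y)

  strictTotalOrder : StrictTotalOrder ℓ ℓ ℓ
  strictTotalOrder = record { isStrictTotalOrder = isStrictTotalOrder }

  open StrictTotalOrderProperties strictTotalOrder public
    using (_≤_; totalOrder)
  open NaturalMax totalOrder public using (_⊔_)
  open AddExtremaStrict _<_ public using (_<±_)
  open AddExtremaNonStrict _≤_ public using (_≤±_)

  abs : Carrier → Carrier
  abs x = x ⊔ (- x)

  -- All |xᵢ| are ≥ 0, so starting the maximum at 0# only fixes the value on M⁰.
  ∥_∥ : ∀ {n} → Vec Carrier n → Carrier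
  ∥ x ∥ = foldr′ _⊔_ 0# (map abs x)

  _-ᵛ_ : ∀ {n} → Vec Carrier n → Vec Carrier n → Vec Carrier n
  _-ᵛ_ = zipWith _-_

-- An expansion (M, <, +, 0, …): Fun and Rl are the additional function and
-- relation symbols, indexed by arity.
record OrderedGroupExpansion (ℓ : Level) : Set (lsuc ℓ) where
  field
    group : OrderedAbelianGroup ℓ
  open OrderedAbelianGroup group public
  field
    Fun  : ℕ → Set ℓ
    Rl   : ℕ → Set ℓ
    ⟦_⟧F : ∀ {k} → Fun k → Vec Carrier k → Carrier
    ⟦_⟧R : ∀ {k} → Rl k → Pred (Vec Carrier k) ℓ

module _ {ℓ : Level} (𝓜 : OrderedGroupExpansion ℓ) where
  open OrderedGroupExpansion 𝓜 renaming (Carrier to M)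

  -- First-order formulas with parameters from M, with n free de Bruijn variables.

  data Term (n : ℕ) : Set ℓ where
    var   : Fin n → Term n
    param : M → Term n
    zeroᵗ : Term n
    _+ᵗ_  : Term n → Term n → Term n
    fun   : ∀ {k} → Fun k → Vec (Term n) k → Term n

  data Formula (n : ℕ) : Set ℓ where
    _≡ᶠ_ _<ᶠ_      : Term n → Term n → Formula n
    rel            : ∀ {k} → Rl k → Vec (Term n) k → Formula n
    ⊥ᶠ             : Formula n
    _∧ᶠ_ _∨ᶠ_ _⇒ᶠ_ : Formula n → Formula n → Formula n
    ∀ᶠ_ ∃ᶠ_        : Formula (suc n) → Formula n

  eval  : ∀ {n} → Vec M n → Term n → M
  evals : ∀ {n k} → Vec M n → Vec (Term n) k → Vec M k
  eval ρ (var i)    = lookup ρ i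
  eval ρ (param a)  = a
  eval ρ zeroᵗ      = 0#
  eval ρ (t +ᵗ u)   = eval ρ t + eval ρ u
  eval ρ (fun f ts) = ⟦ f ⟧F (evals ρ ts)
  evals ρ []        = []
  evals ρ (t ∷ ts)  = eval ρ t ∷ evals ρ ts

  _⊨_ : ∀ {n} → Vec M n → Formula n → Set ℓ
  ρ ⊨ (t ≡ᶠ u)   = eval ρ t ≡ eval ρ u
  ρ ⊨ (t <ᶠ u)   = eval ρ t < eval ρ u
  ρ ⊨ (rel r ts) = ⟦ r ⟧R (evals ρ ts)
  ρ ⊨ ⊥ᶠ         = ⊥
  ρ ⊨ (φ ∧ᶠ ψ)   = (ρ ⊨ φ) × (ρ ⊨ ψ)
  ρ ⊨ (φ ∨ᶠ ψ)   = (ρ ⊨ φ) ⊎ (ρ ⊨ ψ)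
  ρ ⊨ (φ ⇒ᶠ ψ)   = (ρ ⊨ φ) → (ρ ⊨ ψ)
  ρ ⊨ (∀ᶠ φ)     = (a : M) → (a ∷ ρ) ⊨ φ
  ρ ⊨ (∃ᶠ φ)     = ∃[ a ] (a ∷ ρ) ⊨ φ

  Definable : ∀ {n} → Pred (Vec M n) ℓ → Set ℓ
  Definable {n} X = Σ[ φ ∈ Formula n ] (∀ x → x ∈ X ⇔ (x ⊨ φ))

  Definable₁ : Pred M ℓ → Set ℓ
  Definable₁ X = Definable {1} (X ∘ head)

  -- Suprema and infima are taken in M ∪ {±∞}; in particular the supremum of
  -- the empty set is -∞.

  UpperBound LowerBound : Pred M ℓ → Pred (M ±) ℓ
  UpperBound X u = ∀ x → x ∈ X → [ x ] ≤± u
  LowerBound X u = ∀ x → x ∈ X → u ≤± [ x ]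

  IsSupremum IsInfimum : Pred M ℓ → Pred (M ±) ℓ
  IsSupremum X u = UpperBound X u × (∀ v → UpperBound X v → u ≤± v)
  IsInfimum  X u = LowerBound X u × (∀ v → LowerBound X v → v ≤± u)

  DefinablyComplete : Set (lsuc ℓ)
  DefinablyComplete = (X : Pred M ℓ) → Definable₁ X →
    (∃[ u ] IsSupremum X u) × (∃[ l ] IsInfimum X l)

  -- Endpoints of open intervals lie in M ∪ {±∞}.

  Endpoints : Set ℓ
  Endpoints = M ± × M ±

  OpenInterval : Endpoints → Pred M ℓ
  OpenInterval I x = (proj₁ I <± [ x ]) × ([ x ] <± proj₂ I)

  data Piece : Set ℓ where
    point    : M → Piece
    interval : Endpoints → Piece

  _∈ᴾ_ : M → Piece → Set ℓ
  x ∈ᴾ point a    = x ≡ a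
  x ∈ᴾ interval I = x ∈ OpenInterval I

  ⋃ : List Piece → Pred M ℓ
  ⋃ ps x = Any (x ∈ᴾ_) ps

  LocallyOMinimal : Set (lsuc ℓ)
  LocallyOMinimal = (X : Pred M ℓ) → Definable₁ X → (a : M) →
    ∃[ I ] (a ∈ OpenInterval I) × (∃[ ps ] (X ∩ OpenInterval I) ≐ ⋃ ps)

  -- Open boxes are the standard basis of the product of the order topologies.

  OpenBox : ∀ {n} → Vec Endpoints n → Pred (Vec M n) ℓ
  OpenBox B x = Pointwise (λ a I → a ∈ OpenInterval I) x B

  Open : ∀ {n} → Pred (Vec M n) ℓ → Set ℓ
  Open U = ∀ x → x ∈ U → ∃[ B ] (x ∈ OpenBox B) × (OpenBox B ⊆ U)

  Closed : ∀ {n} → Pred (Vec M n) ℓ → Set ℓ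
  Closed C = Open (∁ C)

  Bounded : ∀ {n} → Pred (Vec M n) ℓ → Set ℓ
  Bounded C = ∃[ b ] (∀ x → x ∈ C → ∥ x ∥ ≤ b)

  ⟨0,_⟩ : M → Pred M ℓ
  ⟨0, s ⟩ t = (0# < t) × (t < s)

  -- Functions F : C × (0,s) → M; the membership proofs are irrelevant, so the
  -- value depends on the point (x , t) only.  f_t(x) is F x _ t _.
  Family : ∀ {m} → Pred (Vec M m) ℓ → M → Set ℓ
  Family C s = ∀ x → .(x ∈ C) → ∀ t → .(t ∈ ⟨0, s ⟩) → M

  module _ {m : ℕ} {C : Pred (Vec M m) ℓ} {s : M} (F : Family C s) where

    -- Coordinates are listed as (y , t , x), for y = F(x,t); their order does
    -- not affect definability.
    Graph : Pred (Vec M (suc (suc m))) ℓ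
    Graph (y ∷ t ∷ x) =
      Σ[ x∈C ∈ x ∈ C ] Σ[ t∈ ∈ t ∈ ⟨0, s ⟩ ] F x x∈C t t∈ ≡ y

    DefinableFamily : Set ℓ
    DefinableFamily = Definable Graph

    EquiContinuous : Set ℓ
    EquiContinuous =
      ∀ ε → 0# < ε → ∀ x (x∈C : x ∈ C) →
      ∃[ δ ] (0# < δ) ×
        (∀ t (t∈ : t ∈ ⟨0, s ⟩) x′ (x′∈C : x′ ∈ C) → ∥ x -ᵛ x′ ∥ < δ →
          abs (F x x∈C t t∈ - F x′ x′∈C t t∈) < ε)

    -- f_t is only defined for t < s, so t, t′ ∈ (0,s′) is read within (0,s).

    PointwiseConvergent : Set ℓ
    PointwiseConvergent =
      ∀ ε → 0# < ε → ∀ x (x∈C : x ∈ C) →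
      ∃[ s′ ] (0# < s′) ×
        (∀ t t′ (t∈ : t ∈ ⟨0, s ⟩) (t′∈ : t′ ∈ ⟨0, s ⟩) →
          t ∈ ⟨0, s′ ⟩ → t′ ∈ ⟨0, s′ ⟩ →
          abs (F x x∈C t t∈ - F x x∈C t′ t′∈) < ε)

    UniformlyConvergent : Set ℓ
    UniformlyConvergent =
      ∀ ε → 0# < ε →
      ∃[ s′ ] (0# < s′) ×
        (∀ x (x∈C : x ∈ C) t t′ (t∈ : t ∈ ⟨0, s ⟩) (t′∈ : t′ ∈ ⟨0, s ⟩) →
          t ∈ ⟨0, s′ ⟩ → t′ ∈ ⟨0, s′ ⟩ →
          abs (F x x∈C t t∈ - F x x∈C t′ t′∈) < ε)

{-# OPTIONS --safe #-}

-- Local o-minimality makes satisfaction of every formula decidable, so classical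
-- reasoning about definable sets is available.  If convergence is not uniform
-- for ε, the definable sets D r of those x ∈ C at which f_t and f_t′ differ by
-- at least ε for some t, t′ < r are all non-empty.  They shrink with r, so
-- definable completeness gives them a common cluster point x₀, built
-- coordinate by coordinate as an inferior limit.  As C is closed, x₀ ∈ C, and
-- there pointwise convergence and equi-continuity contradict each other by the
-- usual three-step estimate.

module Submission where

open import Defs
open import Level using (Level; lift; lower)
open import Algebra.Bundles using (AbelianGroup)
import Algebra.Construct.NaturalChoice.Max as NaturalMax
open import Algebra.Structures using (IsAbelianGroup)
import Algebra.Properties.AbelianGroup as AbelianGroupProperties
open import Data.Empty using (⊥-elim)
open import Data.Fin.Base using (Fin; zero; suc; _↑ˡ_; _↑ʳ_)
open import Data.List.Relation.Unary.Any using (any?)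
open import Data.Nat.Base using (ℕ; zero; suc) renaming (_+_ to _+ℕ_)
open import Data.Product.Base using (∃-syntax; _×_; _,_; proj₁; proj₂)
open import Data.Product.Function.NonDependent.Propositional using (_×-⇔_)
open import Data.Sum.Base using (inj₁; inj₂)
open import Data.Sum.Function.Propositional using (_⊎-⇔_)
open import Data.Vec.Base using (Vec; []; _∷_; _++_; lookup; map; tabulate)
open import Data.Vec.Properties using (lookup-++ˡ; lookup-++ʳ)
open import Data.Vec.Relation.Binary.Pointwise.Inductive using ([]; _∷_)
open import Function.Base using (_∘_)
open import Function.Bundles using (_⇔_; mk⇔; Equivalence)
open import Function.Construct.Composition using (_⇔-∘_)
open import Function.Construct.Identity using (⇔-id)
open import Function.Related.TypeIsomorphisms using (→-cong-⇔)
import Relation.Binary.Construct.Add.Extrema.NonStrict as AddExtremaNonStrict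
import Relation.Binary.Construct.Add.Extrema.Strict as AddExtremaStrict
import Relation.Binary.Construct.Add.Supremum.NonStrict as AddSupremumNonStrict
import Relation.Binary.Construct.Add.Supremum.Strict as AddSupremumStrict
open import Relation.Binary.Definitions using (tri<; tri≈; tri>)
open import Relation.Binary.PropositionalEquality
  using (_≡_; refl; sym; trans; cong; cong₂; subst; subst₂)
open import Relation.Binary.Bundles using (TotalOrder)
open import Relation.Binary.Structures using (IsStrictTotalOrder)
open import Relation.Nullary using (¬_; Dec; yes; no)
open import Relation.Nullary.Construct.Add.Extrema using (⊥±; ⊤±; [_])
open import Relation.Nullary.Decidable using (_×-dec_; map′; decidable-stable)
open import Relation.Unary using (Pred; _∈_)
open Equivalence using (to; from)

-- Ordered abelian groups

module _ {ℓ : Level} (𝓖 : OrderedAbelianGroup ℓ) where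
  open OrderedAbelianGroup 𝓖 renaming (Carrier to M)

  private
    abelianGroup : AbelianGroup ℓ ℓ
    abelianGroup = record { isAbelianGroup = isAbelianGroup }

    open AbelianGroup abelianGroup using (assoc; comm; identityʳ; inverseˡ; inverseʳ)
    open AbelianGroupProperties abelianGroup
      using (//-rightDividesˡ; //-rightDividesʳ; xyx⁻¹≈y; ⁻¹-anti-homo‿-)
    open NaturalMax totalOrder using (⊔-sel; x≤x⊔y; x≤y⊔x)
    open TotalOrder totalOrder using () renaming (trans to ≤-trans)

  open IsStrictTotalOrder isStrictTotalOrder
    using (compare; irrefl) renaming (trans to <-trans)

  ≤-<-trans : ∀ {x y z} → x ≤ y → y < z → x < z
  ≤-<-trans (inj₁ x<y)  y<z = <-trans x<y y<z
  ≤-<-trans (inj₂ refl) y<z = y<z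

  <-≤-trans : ∀ {x y z} → x < y → y ≤ z → x < z
  <-≤-trans x<y (inj₁ y<z)  = <-trans x<y y<z
  <-≤-trans x<y (inj₂ refl) = x<y

  ≤⇒≯ : ∀ {x y} → x ≤ y → ¬ (y < x)
  ≤⇒≯ x≤y y<x = irrefl refl (≤-<-trans x≤y y<x)

  ≮⇒≥ : ∀ {x y} → ¬ (x < y) → y ≤ x
  ≮⇒≥ {x} {y} x≮y with compare x y
  ... | tri< x<y _ _ = ⊥-elim (x≮y x<y)
  ... | tri≈ _ x≡y _ = inj₂ (sym x≡y)
  ... | tri> _ _ y<x = inj₁ y<x

  ⊔-lub-< : ∀ {x y z} → x < z → y < z → x ⊔ y < z
  ⊔-lub-< {x} {y} {z} x<z y<z with ⊔-sel x y
  ... | inj₁ eq = subst (_< z) (sym eq) x<z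
  ... | inj₂ eq = subst (_< z) (sym eq) y<z

  x⊔y<z⇒x<z : ∀ {x y z} → x ⊔ y < z → x < z
  x⊔y<z⇒x<z {x} {y} = ≤-<-trans (x≤x⊔y x y)

  x⊔y<z⇒y<z : ∀ {x y z} → x ⊔ y < z → y < z
  x⊔y<z⇒y<z {x} {y} = ≤-<-trans (x≤y⊔x x y)

  x⊔y≤z⇒x≤z : ∀ {x y z} → x ⊔ y ≤ z → x ≤ z
  x⊔y≤z⇒x≤z {x} {y} = ≤-trans (x≤x⊔y x y)

  x⊔y≤z⇒y≤z : ∀ {x y z} → x ⊔ y ≤ z → y ≤ z
  x⊔y≤z⇒y≤z {x} {y} = ≤-trans (x≤y⊔x x y)

  +-monoˡ-< : ∀ z {x y} → x < y → x + z < y + z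
  +-monoˡ-< z {x} {y} x<y = subst₂ _<_ (comm z x) (comm z y) (+-monoʳ-< z x<y)

  +-monoʳ-≤ : ∀ z {x y} → x ≤ y → z + x ≤ z + y
  +-monoʳ-≤ z (inj₁ x<y)  = inj₁ (+-monoʳ-< z x<y)
  +-monoʳ-≤ z (inj₂ refl) = inj₂ refl

  +-cancelʳ-< : ∀ z {x y} → x + z < y + z → x < y
  +-cancelʳ-< z {x} {y} p =
    subst₂ _<_ (//-rightDividesʳ z x) (//-rightDividesʳ z y) (+-monoˡ-< (- z) p)

  x+[y-x]≡y : ∀ x y → x + (y - x) ≡ y
  x+[y-x]≡y x y = trans (comm x (y - x)) (//-rightDividesˡ x y)

  x<y⇒0<y-x : ∀ {x y} → x < y → 0# < y - x
  x<y⇒0<y-x {x} {y} x<y = subst (_< y - x) (inverseʳ x) (+-monoˡ-< (- x) x<y)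

  x<x+ε : ∀ {ε} x → 0# < ε → x < x + ε
  x<x+ε {ε} x 0<ε = subst (_< x + ε) (identityʳ x) (+-monoʳ-< x 0<ε)

  x-y<z⇒x<y+z : ∀ {x y z} → x - y < z → x < y + z
  x-y<z⇒x<y+z {x} {y} {z} p =
    subst₂ _<_ (//-rightDividesˡ y x) (comm z y) (+-monoˡ-< y p)

  x<y+z⇒x-y<z : ∀ {x y z} → x < y + z → x - y < z
  x<y+z⇒x-y<z {x} {y} {z} p =
    subst (x - y <_) (xyx⁻¹≈y y z) (+-monoˡ-< (- y) p)

  abs≤⇒≤ : ∀ {x b} → abs x ≤ b → x ≤ b
  abs≤⇒≤ = x⊔y≤z⇒x≤z

  -- If `x < - b`, adding `b` on the left yields `b + x < - x + x`, hence `b < - x`, against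
  -- `- x ≤ abs x ≤ b`.
  abs≤⇒-≤ : ∀ {x b} → abs x ≤ b → - b ≤ x
  abs≤⇒-≤ {x} {b} ∣x∣≤b = ≮⇒≥ λ x<-b → ≤⇒≯ (x⊔y≤z⇒y≤z {x} ∣x∣≤b)
    (+-cancelʳ-< x (subst (b + x <_) (trans (inverseʳ b) (sym (inverseˡ x)))
      (+-monoʳ-< b x<-b)))

  common-lower-bound : ∀ {x y} → 0# < x → 0# < y → ∃[ z ] (0# < z) × (z ≤ x) × (z ≤ y)
  common-lower-bound {x} {y} 0<x 0<y with compare x y
  ... | tri< x<y _ _ = x , 0<x , inj₂ refl , inj₁ x<y
  ... | tri≈ _ x≡y _ = x , 0<x , inj₂ refl , inj₂ x≡y
  ... | tri> _ _ y<x = y , 0<y , inj₁ y<x , inj₂ refl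

  -- ∣x − y∣ < ε without subtraction, so that it is expressible by terms.
  Near : M → M → M → Set ℓ
  Near ε x y = (x < y + ε) × (y < x + ε)

  near-refl : ∀ {ε} x → 0# < ε → Near ε x x
  near-refl x 0<ε = x<x+ε x 0<ε , x<x+ε x 0<ε

  near-sym : ∀ {ε x y} → Near ε x y → Near ε y x
  near-sym (p , q) = q , p

  near-mono : ∀ {ε ε′ x y} → ε ≤ ε′ → Near ε x y → Near ε′ x y
  near-mono ε≤ε′ (p , q) =
    <-≤-trans p (+-monoʳ-≤ _ ε≤ε′) , <-≤-trans q (+-monoʳ-≤ _ ε≤ε′)

  abs-⇔-near : ∀ {ε x y} → (abs (x - y) < ε) ⇔ Near ε x y
  abs-⇔-near {ε} {x} {y} = mk⇔
    (λ p → x-y<z⇒x<y+z (x⊔y<z⇒x<z p)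
         , x-y<z⇒x<y+z (subst (_< ε) (⁻¹-anti-homo‿- x y) (x⊔y<z⇒y<z {x - y} p)))
    (λ (p , q) → ⊔-lub-< (x<y+z⇒x-y<z p)
                   (subst (_< ε) (sym (⁻¹-anti-homo‿- x y)) (x<y+z⇒x-y<z q)))

  -- Without 0 < d < ε, no two distinct elements are ε-near, which covers
  -- discretely ordered groups.
  halve : ∀ ε → 0# < ε → Dec (∃[ d ] (0# < d) × (d < ε)) →
          ∃[ δ ] (0# < δ) × (∀ {x y z} → Near δ x y → Near δ y z → Near ε x z)
  halve ε 0<ε (yes (d , 0<d , d<ε)) =
    -- The group need not be divisible, so `ε` is split as `d + (ε - d)` and the smaller summand is
    -- the radius.
    let δ , 0<δ , δ≤d , δ≤ε-d = common-lower-bound 0<d (x<y⇒0<y-x d<ε)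
        step : ∀ {x y z} → x < y + δ → y < z + δ → x < z + ε
        step {x} {y} {z} p q = subst (x <_)
          (trans (assoc z d (ε - d)) (cong (z +_) (x+[y-x]≡y d ε)))
          (<-trans (<-≤-trans p (+-monoʳ-≤ y δ≤ε-d))
                   (+-monoˡ-< (ε - d) (<-≤-trans q (+-monoʳ-≤ z δ≤d))))
    in δ , 0<δ , λ (p , p′) (q , q′) → step p q , step q′ p′
  halve ε 0<ε (no ¬d) = ε , 0<ε , λ p q →
      subst (Near ε _) (trans (near⇒≡ p) (near⇒≡ q)) (near-refl _ 0<ε)
    where
    near⇒≮ : ∀ {x y} → Near ε x y → ¬ (x < y)
    near⇒≮ (_ , y<x+ε) x<y = ¬d (_ , x<y⇒0<y-x x<y , x<y+z⇒x-y<z y<x+ε)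

    near⇒≡ : ∀ {x y} → Near ε x y → x ≡ y
    near⇒≡ {x} {y} p with compare x y
    ... | tri< x<y _ _ = ⊥-elim (near⇒≮ p x<y)
    ... | tri≈ _ x≡y _ = x≡y
    ... | tri> _ _ y<x = ⊥-elim (near⇒≮ (near-sym p) y<x)

module _ {ℓ : Level} (𝓜 : OrderedGroupExpansion ℓ) where
  open OrderedGroupExpansion 𝓜 renaming (Carrier to M)
  open IsStrictTotalOrder isStrictTotalOrder
    using (_≟_; _<?_)
  open IsAbelianGroup isAbelianGroup using () renaming (comm to +-comm)

  infix 3 _⊩_
  _⊩_ : ∀ {n} → Vec M n → Formula 𝓜 n → Set ℓ
  _⊩_ = _⊨_ 𝓜

  -- Substitution

  weaken  : ∀ {n} → Term 𝓜 n → Term 𝓜 (suc n)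
  weakens : ∀ {n k} → Vec (Term 𝓜 n) k → Vec (Term 𝓜 (suc n)) k
  weaken (var i)    = var (suc i)
  weaken (param a)  = param a
  weaken zeroᵗ      = zeroᵗ
  weaken (t +ᵗ u)   = weaken t +ᵗ weaken u
  weaken (fun f ts) = fun f (weakens ts)
  weakens []        = []
  weakens (t ∷ ts)  = weaken t ∷ weakens ts

  -- A substitution is a vector of terms, so that `evals` turns it directly into the environment in
  -- which the original expression is read.
  subᵗ  : ∀ {n k} → Vec (Term 𝓜 k) n → Term 𝓜 n → Term 𝓜 k
  subᵗˢ : ∀ {n k l} → Vec (Term 𝓜 k) n → Vec (Term 𝓜 n) l → Vec (Term 𝓜 k) l
  subᵗ σ (var i)    = lookup σ i
  subᵗ σ (param a)  = param a
  subᵗ σ zeroᵗ      = zeroᵗ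
  subᵗ σ (t +ᵗ u)   = subᵗ σ t +ᵗ subᵗ σ u
  subᵗ σ (fun f ts) = fun f (subᵗˢ σ ts)
  subᵗˢ σ []        = []
  subᵗˢ σ (t ∷ ts)  = subᵗ σ t ∷ subᵗˢ σ ts

  lifts : ∀ {n k} → Vec (Term 𝓜 k) n → Vec (Term 𝓜 (suc k)) (suc n)
  lifts σ = var zero ∷ weakens σ

  sub : ∀ {n k} → Vec (Term 𝓜 k) n → Formula 𝓜 n → Formula 𝓜 k
  sub σ (t ≡ᶠ u)   = subᵗ σ t ≡ᶠ subᵗ σ u
  sub σ (t <ᶠ u)   = subᵗ σ t <ᶠ subᵗ σ u
  sub σ (rel r ts) = rel r (subᵗˢ σ ts)
  sub σ ⊥ᶠ         = ⊥ᶠ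
  sub σ (φ ∧ᶠ ψ)   = sub σ φ ∧ᶠ sub σ ψ
  sub σ (φ ∨ᶠ ψ)   = sub σ φ ∨ᶠ sub σ ψ
  sub σ (φ ⇒ᶠ ψ)   = sub σ φ ⇒ᶠ sub σ ψ
  sub σ (∀ᶠ φ)     = ∀ᶠ sub (lifts σ) φ
  sub σ (∃ᶠ φ)     = ∃ᶠ sub (lifts σ) φ

  eval-weaken : ∀ {n} a (ρ : Vec M n) t → eval 𝓜 (a ∷ ρ) (weaken t) ≡ eval 𝓜 ρ t
  evals-weakens : ∀ {n k} a (ρ : Vec M n) (ts : Vec (Term 𝓜 n) k) →
                  evals 𝓜 (a ∷ ρ) (weakens ts) ≡ evals 𝓜 ρ ts
  eval-weaken a ρ (var i)    = refl
  eval-weaken a ρ (param b)  = refl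
  eval-weaken a ρ zeroᵗ      = refl
  eval-weaken a ρ (t +ᵗ u)   = cong₂ _+_ (eval-weaken a ρ t) (eval-weaken a ρ u)
  eval-weaken a ρ (fun f ts) = cong ⟦ f ⟧F (evals-weakens a ρ ts)
  evals-weakens a ρ []       = refl
  evals-weakens a ρ (t ∷ ts) = cong₂ _∷_ (eval-weaken a ρ t) (evals-weakens a ρ ts)

  eval-lookup : ∀ {n k} (ρ : Vec M k) (σ : Vec (Term 𝓜 k) n) i →
                eval 𝓜 ρ (lookup σ i) ≡ lookup (evals 𝓜 ρ σ) i
  eval-lookup ρ (t ∷ σ) zero    = refl
  eval-lookup ρ (t ∷ σ) (suc i) = eval-lookup ρ σ i

  eval-subᵗ : ∀ {n k} (ρ : Vec M k) (σ : Vec (Term 𝓜 k) n) t →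
              eval 𝓜 ρ (subᵗ σ t) ≡ eval 𝓜 (evals 𝓜 ρ σ) t
  evals-subᵗˢ : ∀ {n k l} (ρ : Vec M k) (σ : Vec (Term 𝓜 k) n) (ts : Vec (Term 𝓜 n) l) →
                evals 𝓜 ρ (subᵗˢ σ ts) ≡ evals 𝓜 (evals 𝓜 ρ σ) ts
  eval-subᵗ ρ σ (var i)    = eval-lookup ρ σ i
  eval-subᵗ ρ σ (param a)  = refl
  eval-subᵗ ρ σ zeroᵗ      = refl
  eval-subᵗ ρ σ (t +ᵗ u)   = cong₂ _+_ (eval-subᵗ ρ σ t) (eval-subᵗ ρ σ u)
  eval-subᵗ ρ σ (fun f ts) = cong ⟦ f ⟧F (evals-subᵗˢ ρ σ ts)
  evals-subᵗˢ ρ σ []       = refl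
  evals-subᵗˢ ρ σ (t ∷ ts) = cong₂ _∷_ (eval-subᵗ ρ σ t) (evals-subᵗˢ ρ σ ts)

  ≡⇒⇔ : {A B : Set ℓ} → A ≡ B → A ⇔ B
  ≡⇒⇔ refl = ⇔-id _

  -- Induction on the formula. The environment `ρ′` is tied to `evals 𝓜 ρ σ` only by an equation,
  -- because under a quantifier the lifted substitution evaluates to `a ∷ ρ′` only up to
  -- `evals-weakens`.
  ⊩-sub : ∀ {n k} {ρ : Vec M k} {ρ′ : Vec M n} (σ : Vec (Term 𝓜 k) n) φ →
          evals 𝓜 ρ σ ≡ ρ′ → (ρ ⊩ sub σ φ) ⇔ (ρ′ ⊩ φ)
  ⊩-sub {ρ = ρ} σ (t ≡ᶠ u) refl   = ≡⇒⇔ (cong₂ _≡_ (eval-subᵗ ρ σ t) (eval-subᵗ ρ σ u))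
  ⊩-sub {ρ = ρ} σ (t <ᶠ u) refl   = ≡⇒⇔ (cong₂ _<_ (eval-subᵗ ρ σ t) (eval-subᵗ ρ σ u))
  ⊩-sub {ρ = ρ} σ (rel r ts) refl = ≡⇒⇔ (cong ⟦ r ⟧R (evals-subᵗˢ ρ σ ts))
  ⊩-sub σ ⊥ᶠ eq       = ⇔-id _
  ⊩-sub σ (φ ∧ᶠ ψ) eq = ⊩-sub σ φ eq ×-⇔ ⊩-sub σ ψ eq
  ⊩-sub σ (φ ∨ᶠ ψ) eq = ⊩-sub σ φ eq ⊎-⇔ ⊩-sub σ ψ eq
  ⊩-sub σ (φ ⇒ᶠ ψ) eq = →-cong-⇔ (⊩-sub σ φ eq) (⊩-sub σ ψ eq)
  ⊩-sub {ρ = ρ} {ρ′} σ (∀ᶠ φ) eq = mk⇔ (λ h a → to (under a) (h a)) (λ h a → from (under a) (h a))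
    where
    under : ∀ a → (a ∷ ρ ⊩ sub (lifts σ) φ) ⇔ (a ∷ ρ′ ⊩ φ)
    under a = ⊩-sub (lifts σ) φ (cong (a ∷_) (trans (evals-weakens a ρ σ) eq))
  ⊩-sub {ρ = ρ} {ρ′} σ (∃ᶠ φ) eq =
    mk⇔ (λ (a , h) → a , to (under a) h) (λ (a , h) → a , from (under a) h)
    where
    under : ∀ a → (a ∷ ρ ⊩ sub (lifts σ) φ) ⇔ (a ∷ ρ′ ⊩ φ)
    under a = ⊩-sub (lifts σ) φ (cong (a ∷_) (trans (evals-weakens a ρ σ) eq))

  vars : ∀ {n k} → (Fin n → Fin k) → Vec (Term 𝓜 k) n
  vars f = tabulate (var ∘ f)

  evals-vars : ∀ {n k} {ρ : Vec M k} {f : Fin n → Fin k} (x : Vec M n) →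
               (∀ i → lookup ρ (f i) ≡ lookup x i) → evals 𝓜 ρ (vars f) ≡ x
  evals-vars []      eq = refl
  evals-vars (a ∷ x) eq = cong₂ _∷_ (eq zero) (evals-vars x (eq ∘ suc))

  evals-++ : ∀ {n k l} (ρ : Vec M k) (σ : Vec (Term 𝓜 k) n) (τ : Vec (Term 𝓜 k) l) →
             evals 𝓜 ρ (σ ++ τ) ≡ evals 𝓜 ρ σ ++ evals 𝓜 ρ τ
  evals-++ ρ []      τ = refl
  evals-++ ρ (t ∷ σ) τ = cong (_ ∷_) (evals-++ ρ σ τ)

  evals-params : ∀ {n k} (ρ : Vec M k) (x : Vec M n) → evals 𝓜 ρ (map param x) ≡ x
  evals-params ρ []      = refl
  evals-params ρ (a ∷ x) = cong (a ∷_) (evals-params ρ x)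

  -- Negation and blocks of existential quantifiers

  infix 21 ¬ᶠ_
  ¬ᶠ_ : ∀ {n} → Formula 𝓜 n → Formula 𝓜 n
  ¬ᶠ φ = φ ⇒ᶠ ⊥ᶠ

  ∃*ᶠ : ∀ n {k} → Formula 𝓜 (n +ℕ k) → Formula 𝓜 k
  ∃*ᶠ zero    φ = φ
  ∃*ᶠ (suc n) φ = ∃*ᶠ n (∃ᶠ φ)

  ⊩-∃*ᶠ : ∀ n {k} {ρ : Vec M k} φ → (ρ ⊩ ∃*ᶠ n φ) ⇔ (∃[ y ] y ++ ρ ⊩ φ)
  ⊩-∃*ᶠ zero    φ = mk⇔ ([] ,_) λ { ([] , h) → h }
  ⊩-∃*ᶠ (suc n) φ = mk⇔ (λ (y , a , h) → a ∷ y , h) (λ { (a ∷ y , h) → y , a , h })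
    ⇔-∘ ⊩-∃*ᶠ n (∃ᶠ φ)

  -- Quantifiers bind the front variables, while the block to be projected away stands at the end; a
  -- substitution first exchanges the two blocks.
  ∃ᵛᶠ : ∀ k {n} → Formula 𝓜 (k +ℕ n) → Formula 𝓜 k
  ∃ᵛᶠ k {n} φ = ∃*ᶠ n (sub (vars (n ↑ʳ_) ++ vars (_↑ˡ k)) φ)

  ⊩-∃ᵛᶠ : ∀ {k n} {ρ : Vec M k} (φ : Formula 𝓜 (k +ℕ n)) →
          (ρ ⊩ ∃ᵛᶠ k φ) ⇔ (∃[ y ] ρ ++ y ⊩ φ)
  ⊩-∃ᵛᶠ {k} {n} {ρ} φ = mk⇔ (λ (y , h) → y , to (swap y) h) (λ (y , h) → y , from (swap y) h)
    ⇔-∘ ⊩-∃*ᶠ n _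
    where
    swap : ∀ y → (y ++ ρ ⊩ sub (vars (n ↑ʳ_) ++ vars (_↑ˡ k)) φ) ⇔ (ρ ++ y ⊩ φ)
    swap y = ⊩-sub _ φ (trans (evals-++ (y ++ ρ) (vars (n ↑ʳ_)) (vars (_↑ˡ k)))
      (cong₂ _++_ (evals-vars ρ (lookup-++ʳ y ρ)) (evals-vars y (lookup-++ˡ y ρ))))

  -- Distances and boxes

  ∷-near : ∀ {n δ a b} {x y : Vec M n} →
           Near group δ a b → ∥ x -ᵛ y ∥ < δ → ∥ (a ∷ x) -ᵛ (b ∷ y) ∥ < δ
  ∷-near p q = ⊔-lub-< group (from (abs-⇔-near group) p) q

  head-near : ∀ {n δ a b} {x y : Vec M n} → ∥ (a ∷ x) -ᵛ (b ∷ y) ∥ < δ → Near group δ a b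
  head-near p = to (abs-⇔-near group) (x⊔y<z⇒x<z group p)

  tail-near : ∀ {n δ} a b {x y : Vec M n} → ∥ (a ∷ x) -ᵛ (b ∷ y) ∥ < δ → ∥ x -ᵛ y ∥ < δ
  tail-near a b p = x⊔y<z⇒y<z group {abs (a - b)} p

  private
    module Strict    = AddExtremaStrict _<_
    module NonStrict = AddExtremaNonStrict _≤_

  module _ {e : M} (0<e : 0# < e) where

    -- A finite endpoint `c` allows the radius `a - c`. An infinite one allows every positive
    -- radius, and `e` supplies one.
    lower-ball : ∀ {a} l → l <± [ a ] →
                 ∃[ δ ] (0# < δ) × (∀ {b} → Near group δ a b → l <± [ b ])
    lower-ball ⊥±    _         = e , 0<e , λ _ → Strict.⊥±<[ _ ]
    lower-ball {a} [ c ] c<a   = a - c , x<y⇒0<y-x group (Strict.[<]-injective c<a) ,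
      λ {b} (p , _) → Strict.[ +-cancelʳ-< group (a - c)
        (subst (_< b + (a - c)) (sym (x+[y-x]≡y group c a)) p) ]

    upper-ball : ∀ {a} u → [ a ] <± u →
                 ∃[ δ ] (0# < δ) × (∀ {b} → Near group δ a b → [ b ] <± u)
    upper-ball ⊤±    _         = e , 0<e , λ _ → Strict.[ _ ]<⊤±
    upper-ball {a} [ c ] a<c   = c - a , x<y⇒0<y-x group (Strict.[<]-injective a<c) ,
      λ {b} (_ , q) → Strict.[ subst (b <_) (x+[y-x]≡y group a c) q ]
    upper-ball ⊥± AddSupremumStrict.[ () ]

    -- This connects the product topology, in which closedness is stated, with the norm, in which
    -- equi-continuity is stated. The least of the finitely many radii coming from the endpoints
    -- works; in dimension zero `e` is the default.
    box-ball : ∀ {n} (x : Vec M n) B → OpenBox 𝓜 B x →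
               ∃[ δ ] (0# < δ) × (∀ y → ∥ x -ᵛ y ∥ < δ → OpenBox 𝓜 B y)
    box-ball []      []            []              = e , 0<e , λ { [] _ → [] }
    box-ball (a ∷ x) ((l , u) ∷ B) ((l<a , a<u) ∷ x∈B) =
      let δ₁ , 0<δ₁ , low  = lower-ball l l<a
          δ₂ , 0<δ₂ , high = upper-ball u a<u
          δ₃ , 0<δ₃ , rest = box-ball x B x∈B
          δ₁₂ , 0<δ₁₂ , ≤₁ , ≤₂ = common-lower-bound group 0<δ₁ 0<δ₂
          δ , 0<δ , ≤₁₂ , ≤₃ = common-lower-bound group 0<δ₁₂ 0<δ₃
      in δ , 0<δ , λ { (b ∷ y) p →
           let near = near-mono group ≤₁₂ (head-near {x = x} {y} p)
           in (low (near-mono group ≤₁ near) , high (near-mono group ≤₂ near))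
              ∷ rest y (<-≤-trans group (tail-near a b {x} {y} p) ≤₃) }

  -- Definable compactness

  module _ (complete : DefinablyComplete 𝓜) (locallyOMinimal : LocallyOMinimal 𝓜) where

    private
      x₀ : ∀ {n} → Term 𝓜 (1 +ℕ n)
      x₀ = var zero

      x₁ : ∀ {n} → Term 𝓜 (2 +ℕ n)
      x₁ = var (suc zero)

      x₂ : ∀ {n} → Term 𝓜 (3 +ℕ n)
      x₂ = var (suc (suc zero))

      x₃ : ∀ {n} → Term 𝓜 (4 +ℕ n)
      x₃ = var (suc (suc (suc zero)))

      x₄ : ∀ {n} → Term 𝓜 (5 +ℕ n)
      x₄ = var (suc (suc (suc (suc zero))))

    -- The set of all c : M such that ρ ⊩ φ is definable, and whether 0# belongs
    -- to a given finite union of points and intervals can be decided.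
    _⊩?_ : ∀ {n} (ρ : Vec M n) φ → Dec (ρ ⊩ φ)
    ρ ⊩? φ with locallyOMinimal (λ _ → ρ ⊩ φ)
                  (sub (map param ρ) φ , λ x →
                     mk⇔ (from (⊩-sub _ φ (evals-params x ρ))) (to (⊩-sub _ φ (evals-params x ρ)))) 0#
    ... | I , 0∈I , ps , ⊆ps , ps⊆ =
      map′ (proj₁ ∘ ps⊆) (λ h → ⊆ps (h , 0∈I)) (any? (_∈ᴾ?_ 0#) ps)
      where
      _<±?_ = Strict.<±-dec _<?_

      _∈ᴾ?_ : ∀ x P → Dec (_∈ᴾ_ 𝓜 x P)
      x ∈ᴾ? point a          = x ≟ a
      x ∈ᴾ? interval (l , u) = (l <±? [ x ]) ×-dec ([ x ] <±? u)

    ¬ᶠ⇒¬ : ∀ {n} {ρ : Vec M n} φ → ρ ⊩ ¬ᶠ φ → ¬ (ρ ⊩ φ)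
    ¬ᶠ⇒¬ φ h p = lower (h p)

    ¬⇒¬ᶠ : ∀ {n} {ρ : Vec M n} φ → ¬ (ρ ⊩ φ) → ρ ⊩ ¬ᶠ φ
    ¬⇒¬ᶠ φ h p = lift (h p)

    -- The member `a` excludes the supremum `⊥±`, and the upper bound `b` excludes `⊤±`.
    finite-supremum : (φ : Formula 𝓜 1) → ∀ {a b} → a ∷ [] ⊩ φ → (∀ c → c ∷ [] ⊩ φ → c ≤ b) →
      ∃[ u ] (∀ c → c ∷ [] ⊩ φ → c ≤ u) × (∀ v → (∀ c → c ∷ [] ⊩ φ → c ≤ v) → u ≤ v)
    finite-supremum φ {a} {b} φa φ≤b
      with complete (λ c → c ∷ [] ⊩ φ) (φ , λ { (_ ∷ []) → ⇔-id _ }) .proj₁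
    ... | [ u ] , upper , least = u , (λ c φc → NonStrict.[≤]-injective (upper c φc)) ,
                                  λ v φ≤v → NonStrict.[≤]-injective (least [ v ] λ c φc → NonStrict.[ φ≤v c φc ])
    ... | ⊥± , upper , least with upper a φa
    ...   | AddSupremumNonStrict.[ () ]
    finite-supremum φ {a} {b} φa φ≤b | ⊤± , upper , least with least [ b ] (λ c φc → NonStrict.[ φ≤b c φc ])
    ... | ()

    -- The case distinction in `halve` is a sentence with parameter `ε`, hence decidable.
    halve-definable : ∀ ε → 0# < ε →
      ∃[ δ ] (0# < δ) × (∀ {x y z} → Near group δ x y → Near group δ y z → Near group ε x z)
    halve-definable ε 0<ε = halve group ε 0<ε
      ([] ⊩? (∃ᶠ ((zeroᵗ <ᶠ x₀) ∧ᶠ (x₀ <ᶠ param ε))))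

    module _ {e : M} (0<e : 0# < e) where

      -- φ describes a family of sets D r ⊆ Mⁿ, the parameter r being its first variable.
      cluster-point : ∀ n (φ : Formula 𝓜 (suc n)) b →
        (∀ r r′ x → r ≤ r′ → r ∷ x ⊩ φ → r′ ∷ x ⊩ φ) →
        (∀ r x → r ∷ x ⊩ φ → ∥ x ∥ ≤ b) →
        (∀ r → 0# < r → ∃[ x ] r ∷ x ⊩ φ) →
        ∃[ x ] (∀ r → 0# < r → ∀ δ → 0# < δ → ∃[ y ] (r ∷ y ⊩ φ) × (∥ x -ᵛ y ∥ < δ))
      cluster-point zero φ b mono bounded inhabited =
        [] , λ r 0<r δ 0<δ → let y , h = inhabited r 0<r in y , h , near-[] y 0<δ
        where
        near-[] : ∀ {δ} y → 0# < δ → ∥ [] -ᵛ y ∥ < δ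
        near-[] [] 0<δ = 0<δ
      cluster-point (suc n) φ b mono bounded inhabited = a₀ ∷ x , λ r 0<r δ 0<δ →
          -- In a slice the index also bounds the distance of the first coordinate from `a₀`. Hence
          -- `μ` has to lie below `r`, to end in D r, and below `δ`, to be close enough.
          let μ , 0<μ , μ≤r , μ≤δ = common-lower-bound group 0<r 0<δ
              y , h , d = cluster μ 0<μ δ 0<δ
              a , q , p = to ⊩-slice h
          in a ∷ y , mono μ r (a ∷ y) μ≤r p
           , ∷-near {x = x} {y} (near-mono group μ≤δ (near-sym group q)) d
        where
        below : Formula 𝓜 2
        below = ∃ᶠ (sub (x₁ ∷ x₀ ∷ []) (∃ᵛᶠ 2 φ) ∧ᶠ (x₀ <ᶠ x₂))

        ⊩-below : ∀ {r c} → (r ∷ c ∷ [] ⊩ below) ⇔ (∃[ a ] ∃[ y ] (r ∷ a ∷ y ⊩ φ) × (a < c))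
        ⊩-below = mk⇔
          (λ (a , h , a<c) → let y , p = to (⊩-∃ᵛᶠ φ) (to (⊩-sub _ (∃ᵛᶠ 2 φ) refl) h) in a , y , p , a<c)
          (λ (a , y , p , a<c) → a , from (⊩-sub _ (∃ᵛᶠ 2 φ) refl) (from (⊩-∃ᵛᶠ φ) (y , p)) , a<c)

        -- The supremum of these c is the inferior limit, as r → 0, of the
        -- first coordinate on D r.
        eventually-above : Formula 𝓜 1
        eventually-above = ∃ᶠ ((zeroᵗ <ᶠ x₀) ∧ᶠ ¬ᶠ below)

        ∣head∣≤b : ∀ {r} a y → r ∷ a ∷ y ⊩ φ → abs a ≤ b
        ∣head∣≤b a y p = x⊔y≤z⇒x≤z group (bounded _ (a ∷ y) p)

        inhabited-∷ : ∀ r → 0# < r → ∃[ a ] ∃[ y ] r ∷ a ∷ y ⊩ φ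
        inhabited-∷ r 0<r with inhabited r 0<r
        ... | a ∷ y , p = a , y , p

        -- The element `- b` belongs to the set, with index `e`, since no first coordinate is
        -- smaller. No `c` above `b` belongs to it: each D r has a point, and its first coordinate
        -- is at most `b`.
        supremum = finite-supremum eventually-above { - b} {b}
          (e , 0<e , ¬⇒¬ᶠ below λ h →
            let a , y , p , a<-b = to ⊩-below h
            in ≤⇒≯ group (abs≤⇒-≤ group (∣head∣≤b a y p)) a<-b)
          (λ c (r , 0<r , ¬h) → ≮⇒≥ group λ b<c →
            let a , y , p = inhabited-∷ r 0<r
            in ¬ᶠ⇒¬ below ¬h (from ⊩-below
                 (a , y , p , ≤-<-trans group (abs≤⇒≤ group (∣head∣≤b a y p)) b<c)))

        a₀ = proj₁ supremum

        -- Otherwise `a₀ - r` would be an upper bound smaller than the least one. The existence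
        -- claim is a sentence with parameters, so refuting its negation suffices.
        eventually-above-near : ∀ r → 0# < r →
          ∃[ c ] (c ∷ [] ⊩ eventually-above) × (a₀ - r < c)
        eventually-above-near r 0<r = decidable-stable
          ([] ⊩? (∃ᶠ (eventually-above ∧ᶠ (param (a₀ - r) <ᶠ x₀)))) λ none →
            ≤⇒≯ group
              (proj₂ (proj₂ supremum) (a₀ - r) λ c h → ≮⇒≥ group λ q → none (c , h , q))
              (x<y+z⇒x-y<z group (subst (a₀ <_) (+-comm a₀ r) (x<x+ε group a₀ 0<r)))

        -- Otherwise the index `μ` would put `a₀ + r` into `eventually-above`, beyond its supremum.
        below-near : ∀ r μ → 0# < r → 0# < μ → ∃[ a ] ∃[ y ] (μ ∷ a ∷ y ⊩ φ) × (a < a₀ + r)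
        below-near r μ 0<r 0<μ = to ⊩-below (decidable-stable ((μ ∷ a₀ + r ∷ []) ⊩? below) λ ¬h →
          ≤⇒≯ group (proj₁ (proj₂ supremum) (a₀ + r) (μ , 0<μ , ¬⇒¬ᶠ below ¬h)) (x<x+ε group a₀ 0<r))

        -- The index `r` doubles as the tolerance around `a₀`. The slices therefore again form a
        -- one-parameter family shrinking with `r`, to which the induction on dimension applies.
        slice : Formula 𝓜 (suc n)
        slice = ∃ᶠ (((x₀ <ᶠ (param a₀ +ᵗ x₁)) ∧ᶠ (param a₀ <ᶠ (x₀ +ᵗ x₁)))
                    ∧ᶠ sub (x₁ ∷ x₀ ∷ vars (2 ↑ʳ_)) φ)

        ⊩-slice : ∀ {r y} → (r ∷ y ⊩ slice) ⇔ (∃[ a ] Near group r a a₀ × (r ∷ a ∷ y ⊩ φ))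
        ⊩-slice {r} {y} = mk⇔ (λ (a , q , h) → a , q , to (reorder a) h)
                              (λ (a , q , h) → a , q , from (reorder a) h)
          where
          reorder : ∀ a → (a ∷ r ∷ y ⊩ sub (x₁ ∷ x₀ ∷ vars (2 ↑ʳ_)) φ) ⇔ (r ∷ a ∷ y ⊩ φ)
          reorder a = ⊩-sub _ φ (cong (λ z → r ∷ a ∷ z) (evals-vars y λ _ → refl))

        -- Choose `c > a₀ - r` that no first coordinate on D r₁ undercuts. For `μ` below `r` and
        -- `r₁`, the set D μ has a point with first coordinate under `a₀ + r`; as this point also
        -- lies in D r₁, that coordinate is at least `c`.
        slice-inhabited : ∀ r → 0# < r → ∃[ y ] r ∷ y ⊩ slice
        slice-inhabited r 0<r =
          let c , (r₁ , 0<r₁ , ¬h) , a₀-r<c = eventually-above-near r 0<r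
              μ , 0<μ , μ≤r , μ≤r₁ = common-lower-bound group 0<r 0<r₁
              a , y , p , a<a₀+r = below-near r μ 0<r 0<μ
              c≤a = ≮⇒≥ group λ a<c →
                ¬ᶠ⇒¬ below ¬h (from ⊩-below (a , y , mono μ r₁ (a ∷ y) μ≤r₁ p , a<c))
              a₀<a+r = subst (a₀ <_) (+-comm r a)
                (x-y<z⇒x<y+z group (<-≤-trans group a₀-r<c c≤a))
          in y , from ⊩-slice (a , (a<a₀+r , a₀<a+r) , mono μ r (a ∷ y) μ≤r p)

        tail-cluster = cluster-point n slice b
          (λ r r′ y r≤r′ h → let a , q , p = to ⊩-slice h
                             in from ⊩-slice (a , near-mono group r≤r′ q , mono r r′ (a ∷ y) r≤r′ p))
          (λ r y h → let a , _ , p = to ⊩-slice h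
                     in x⊔y≤z⇒y≤z group {abs a} (bounded r (a ∷ y) p))
          slice-inhabited

        x = proj₁ tail-cluster

        cluster = proj₂ tail-cluster

    -- Uniform convergence

    module _ {m : ℕ} {C : Pred (Vec M m) ℓ} (C-definable : Definable 𝓜 C)
             (closed : Closed 𝓜 C) (bounded : Bounded 𝓜 C)
             {s : M} (0<s : 0# < s) (F : Family 𝓜 C s) (F-definable : DefinableFamily 𝓜 F)
             (pointwise : PointwiseConvergent 𝓜 F) (equicontinuous : EquiContinuous 𝓜 F) where

      private
        χ   = proj₁ C-definable
        C⇔χ = proj₂ C-definable
        γ   = proj₁ F-definable
        F⇔γ = proj₂ F-definable

      -- Off `C`, the point `x` would have a whole ball missing `C`. Membership in `C` is given by a
      -- formula, so the contradiction proves it.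
      adherent⇒∈ : ∀ x → (∀ δ → 0# < δ → ∃[ y ] (y ∈ C) × (∥ x -ᵛ y ∥ < δ)) → x ∈ C
      adherent⇒∈ x adherent = decidable-stable
        (map′ (from (C⇔χ x)) (to (C⇔χ x)) (x ⊩? χ)) λ x∉C →
          let B , x∈B , B⊆∁C = closed x x∉C
              δ , 0<δ , ball⊆B = box-ball 0<s x B x∈B
              y , y∈C , d = adherent δ 0<δ
          in B⊆∁C (ball⊆B y d) y∈C

      -- Sets of oscillation at least `ε`

      module _ (ε : M) where

        -- The values are quantified and tied to `F` through `Graph`, the form in which `F` is known
        -- to be definable. `Graph` also carries `0# < t` and `t < s`.
        Oscillates : M → Vec M m → Set ℓ
        Oscillates r x = ∃[ t ] ∃[ t′ ] ∃[ y ] ∃[ y′ ]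
          ((t < r) × (t′ < r)) × (Graph 𝓜 F (y ∷ t ∷ x) × Graph 𝓜 F (y′ ∷ t′ ∷ x)) × ¬ Near group ε y y′

        -- Under the four quantifiers the variables are, in order, `y′`, `y`, `t′`, `t`, `r` and
        -- then the coordinates of `x`.
        oscillates : Formula 𝓜 (suc m)
        oscillates = ∃ᶠ ∃ᶠ ∃ᶠ ∃ᶠ
          (((x₃ <ᶠ x₄) ∧ᶠ (x₂ <ᶠ x₄))
            ∧ᶠ ((sub (x₁ ∷ x₃ ∷ vars (5 ↑ʳ_)) γ ∧ᶠ sub (x₀ ∷ x₂ ∷ vars (5 ↑ʳ_)) γ)
            ∧ᶠ ¬ᶠ ((x₁ <ᶠ (x₀ +ᵗ param ε)) ∧ᶠ (x₀ <ᶠ (x₁ +ᵗ param ε)))))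

        ⊩-oscillates : ∀ {r x} → (r ∷ x ⊩ oscillates) ⇔ Oscillates r x
        ⊩-oscillates {r} {x} = mk⇔
          (λ (t , t′ , y , y′ , t<r , (g , g′) , far) →
            t , t′ , y , y′ , t<r , (to (graph refl) g , to (graph refl) g′) , lower ∘ far)
          (λ (t , t′ , y , y′ , t<r , (g , g′) , far) →
            t , t′ , y , y′ , t<r , (from (graph refl) g , from (graph refl) g′) , lift ∘ far)
          where
          graph : ∀ {t t′ y y′ y″ t″ u v} →
            let ρ = y′ ∷ y ∷ t′ ∷ t ∷ r ∷ x in
            evals 𝓜 ρ (u ∷ v ∷ []) ≡ y″ ∷ t″ ∷ [] →
            (ρ ⊩ sub (u ∷ v ∷ vars (5 ↑ʳ_)) γ) ⇔ Graph 𝓜 F (y″ ∷ t″ ∷ x)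
          graph {y″ = y″} {t″} refl = mk⇔ (from (F⇔γ _)) (to (F⇔γ _))
            ⇔-∘ ⊩-sub _ γ (cong (λ z → y″ ∷ t″ ∷ z) (evals-vars x λ _ → refl))

        oscillates⇒∈ : ∀ {r x} → Oscillates r x → x ∈ C
        oscillates⇒∈ (_ , _ , _ , _ , _ , ((x∈C , _) , _) , _) = x∈C

        oscillation-vanishes : 0# < ε → ¬ (∀ r → 0# < r → ∃[ x ] Oscillates r x)
        oscillation-vanishes 0<ε inhabited =
          -- Halving twice leaves room for four steps of size `δ₂`; the estimate takes three.
          let δ₁ , 0<δ₁ , halve₁ = halve-definable ε 0<ε
              δ₂ , 0<δ₂ , halve₂ = halve-definable δ₁ 0<δ₁
              x , cluster = cluster-point 0<s m oscillates (proj₁ bounded)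
                (λ r r′ x r≤r′ h →
                  let t , t′ , y , y′ , (t<r , t′<r) , rest = to ⊩-oscillates h
                  in from ⊩-oscillates
                       (t , t′ , y , y′ , (<-≤-trans group t<r r≤r′ , <-≤-trans group t′<r r≤r′) , rest))
                (λ r x h → proj₂ bounded x (oscillates⇒∈ (to (⊩-oscillates {r} {x}) h)))
                (λ r 0<r → let x , h = inhabited r 0<r in x , from ⊩-oscillates h)
              -- Every D r lies in `C`; the index `s` is just a positive one at hand.
              x∈C = adherent⇒∈ x λ δ 0<δ →
                let y , h , d = cluster s 0<s δ 0<δ in y , oscillates⇒∈ (to (⊩-oscillates {s} {y}) h) , d
              r , 0<r , pw = pointwise δ₂ 0<δ₂ x x∈C
              δ , 0<δ , ec = equicontinuous δ₂ 0<δ₂ x x∈C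
              -- The threshold from pointwise convergence at `x` is the index and the radius from
              -- equi-continuity is the distance, so both estimates apply to the same `t` and `t′`.
              x′ , h , d = cluster r 0<r δ 0<δ
              _ , _ , _ , _ , (t<r , t′<r) , ((x′∈C , t∈ , eq) , (_ , t′∈ , eq′)) , far = to ⊩-oscillates h
              near-t  = to (abs-⇔-near group) (ec _ t∈ x′ x′∈C d)
              near-t′ = to (abs-⇔-near group) (ec _ t′∈ x′ x′∈C d)
              near-x  = to (abs-⇔-near group) (pw _ _ t∈ t′∈ (proj₁ t∈ , t<r) (proj₁ t′∈ , t′<r))
          in far (subst₂ (Near group ε) eq eq′
               -- The chain runs from `t` at `x′` to `t` at `x`, to `t′` at `x`, to `t′` at `x′`. A
               -- trivial fourth step widens the last tolerance from `δ₂` to `δ₁`.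
               (halve₁ (halve₂ (near-sym group near-t) near-x)
                       (halve₂ near-t′ (near-refl group _ 0<δ₂))))

      -- Whether some D r with `0# < r` is empty is a decidable sentence. Such an `r` is the
      -- required threshold, and if there is none, `oscillation-vanishes` is contradicted.
      uniformly-convergent : UniformlyConvergent 𝓜 F
      uniformly-convergent ε 0<ε with [] ⊩? (∃ᶠ ((zeroᵗ <ᶠ x₀) ∧ᶠ ¬ᶠ ∃ᵛᶠ 1 (oscillates ε)))
      ... | yes (r , 0<r , ¬osc) = r , 0<r , λ x x∈C t t′ t∈ t′∈ t<r t′<r →
              from (abs-⇔-near group) (decidable-stable ((_ <? _) ×-dec (_ <? _)) λ far →
                ¬ᶠ⇒¬ (∃ᵛᶠ 1 (oscillates ε)) ¬osc (from (⊩-∃ᵛᶠ (oscillates ε)) (x , from (⊩-oscillates ε)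
                  (t , t′ , _ , _ , (proj₂ t<r , proj₂ t′<r)
                    , ((x∈C , t∈ , refl) , (x∈C , t′∈ , refl)) , far))))
      ... | no ¬vanishing = ⊥-elim (oscillation-vanishes ε 0<ε λ r 0<r →
              let x , h = to (⊩-∃ᵛᶠ (oscillates ε))
                    (decidable-stable ((r ∷ []) ⊩? ∃ᵛᶠ 1 (oscillates ε)) λ ¬osc →
                      ¬vanishing (r , 0<r , ¬⇒¬ᶠ (∃ᵛᶠ 1 (oscillates ε)) ¬osc))
              in x , to (⊩-oscillates ε) h)

open OrderedGroupExpansion using (Carrier; _<_; 0#)

mainTheorem1 : ∀ {ℓ : Level} (𝓜 : OrderedGroupExpansion ℓ) →
    DefinablyComplete 𝓜 → LocallyOMinimal 𝓜 →
    (m : ℕ) (C : Pred (Vec (Carrier 𝓜) m) ℓ) →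
    Definable 𝓜 C → Closed 𝓜 C → Bounded 𝓜 C →
    (s : Carrier 𝓜) → _<_ 𝓜 (0# 𝓜) s →
    (F : Family 𝓜 C s) → DefinableFamily 𝓜 F →
    PointwiseConvergent 𝓜 F → EquiContinuous 𝓜 F →
    UniformlyConvergent 𝓜 F
mainTheorem1 𝓜 complete locallyOMinimal m C C-definable closed bounded s 0<s F F-definable =
  uniformly-convergent 𝓜 complete locallyOMinimal C-definable closed bounded 0<s F F-definable
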